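{- Let $n$ be a nonnegative integer. For every integer $p\ge 1$, the mapping $\Pi_{n+p}:\Lambda_{n+p}\to\Lambda_n$ defined by setting $\mathbf x_{n+1}=0,\ \mathbf x_{n+2}=0,\ \dots,\ \mathbf x_{n+p}=0$ is a surjective homomorphism of graded rings. Furthermore, the restriction $$\Pi_{n+p}^r:=\Pi_{n+p}|_{\Lambda_{n+p}^r}:\Lambda_{n+p}^r\to\Lambda_n^r$$ is surjective for all $r\ge 0$, and is an isomorphism if and only if $r\le n$.
   Context: $\Lambda_n=\mathbb Z[\mathbf x_1,\dots,\mathbf x_n]^{S_n}$ is the graded ring of symmetric polynomials with integer coefficients in $n$ independent indeterminates, and $\Lambda_n^r$ is the additive group of homogeneous symmetric polynomials of degree $r$ in $\mathbf x_1,\dots,\mathbf x_n$ (with $0$ homogeneous of every degree), so that $\Lambda_n=\bigoplus_{r\ge0}\Lambda_n^r$ and $\Lambda_n^0=\mathbb Z$. For $n=0$, $\Lambda_0=\mathbb Z$. -}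

module Defs where

open import Algebra.Bundles using (AbelianGroup; CommutativeRing; RawGroup; RawRing)
open import Algebra.Morphism.Structures
  using (IsGroupMonomorphism; IsRingMonomorphism)
import Algebra.Definitions.RawSemiring as RawSemiringDefs
import Algebra.Morphism.GroupMonomorphism as GroupMono
import Algebra.Morphism.RingMonomorphism as RingMono
import Algebra.Properties.CommutativeMonoid.Sum as CMSum
import Algebra.Properties.Semiring.Exp as Exp
open import Data.Bool.Base using (if_then_else_)
open import Data.Fin.Base using (Fin; zero; suc; splitAt; _↑ˡ_; _↑ʳ_)
open import Data.Fin.Permutation using (Permutation′; _⟨$⟩ʳ_)
open import Data.Fin.Properties using (+↔⊎; splitAt-↑ˡ; splitAt-↑ʳ)
open import Data.Integer.Base as ℤ using (ℤ; 0ℤ; 1ℤ)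
import Data.Integer.Properties as ℤ
open import Data.Integer.Tactic.RingSolver using (solve-∀)
open import Data.List.Base as List
  using (List; []; _∷_; _++_; cartesianProductWith; deduplicate)
open import Data.List.Membership.Propositional using (_∈_)
open import Data.List.Membership.Propositional.Properties
  using (∈-++⁺ˡ; ∈-++⁺ʳ; ∈-deduplicate⁺)
open import Data.List.Relation.Unary.All as All using (All; []; _∷_)
open import Data.List.Relation.Unary.Any using (here; there)
open import Data.List.Relation.Unary.Unique.Propositional using (Unique; []; _∷_)
open import Data.List.Relation.Unary.Unique.DecPropositional.Properties using (deduplicate-!)
open import Data.Nat.Base as ℕ using (ℕ; zero; suc)
import Data.Nat.Properties as ℕ
open import Data.Product.Base using (Σ; _×_; _,_; proj₁; proj₂)
open import Data.Sum.Base using (inj₁; inj₂; [_,_]′)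
open import Data.Sum.Function.Propositional using (_⊎-↔_)
open import Data.Vec.Base as Vec using (Vec; []; _∷_; lookup; replicate; zipWith; _[_]≔_)
import Data.Vec.Properties as Vec
open import Function.Base using (_∘_; const)
import Function.Construct.Composition as Compose
open import Function.Construct.Identity using (↔-id)
open import Function.Construct.Symmetry using (↔-sym)
open import Level using (0ℓ)
open import Relation.Binary.PropositionalEquality
  using (_≡_; _≢_; refl; sym; trans; cong; cong₂; module ≡-Reasoning)
open import Relation.Binary.Definitions using (DecidableEquality)
open import Relation.Binary.Structures using (IsEquivalence)
open import Relation.Nullary using (does; yes; no; contradiction)

private
  variable
    m n k p r : ℕ

Exponent : ℕ → Set
Exponent n = Vec ℕ n

degree : Exponent n → ℕ
degree = Vec.sum

-- A polynomial is a finite formal sum of terms. Repeated exponents and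
-- zero coefficients are allowed, so polynomials are compared through
-- their coefficients, by _≈_ below.
Term : ℕ → Set
Term n = ℤ × Exponent n

Poly : ℕ → Set
Poly n = List (Term n)

_≟ₑ_ : DecidableEquality (Exponent n)
_≟ₑ_ = Vec.≡-dec ℕ._≟_

coeff : Poly n → Exponent n → ℤ
coeff []            α = 0ℤ
coeff ((c , β) ∷ f) α = (if does (β ≟ₑ α) then c else 0ℤ) ℤ.+ coeff f α

-- A record, so that Agda can infer f and g from a proof of f ≈ g.
infix 4 _≈_
record _≈_ (f g : Poly n) : Set where
  constructor mk≈
  field
    coeff-≡ : ∀ α → coeff f α ≡ coeff g α
open _≈_ public

infixl 6 _+ₚ_
infixl 7 _*ₚ_
infix  8 -ₚ_

0ₚ : Poly n
0ₚ = []

constₚ : ℤ → Poly n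
constₚ c = (c , replicate _ 0) ∷ []

1ₚ : Poly n
1ₚ = constₚ 1ℤ

var : Fin n → Poly n
var i = (1ℤ , replicate _ 0 [ i ]≔ 1) ∷ []

_+ₚ_ : Poly n → Poly n → Poly n
_+ₚ_ = _++_

-ₚ_ : Poly n → Poly n
-ₚ_ = List.map (λ (c , α) → ℤ.- c , α)

_⊗_ : Term n → Term n → Term n
(c , α) ⊗ (d , β) = c ℤ.* d , zipWith ℕ._+_ α β

_*ₚ_ : Poly n → Poly n → Poly n
_*ₚ_ = cartesianProductWith _⊗_

rawPolyRing : ℕ → RawRing 0ℓ 0ℓ
rawPolyRing n = record
  { Carrier = Poly n ; _≈_ = _≈_ ; _+_ = _+ₚ_ ; _*_ = _*ₚ_ ; -_ = -ₚ_ ; 0# = 0ₚ ; 1# = 1ₚ }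

module _ {n : ℕ} where
  open RawSemiringDefs (RawRing.rawSemiring (rawPolyRing n)) public
    using (_^_; product)

-- f ⟦ ρ ⟧ is the result of substituting ρ i for the i-th indeterminate.
monomialAt : (Fin m → Poly n) → Exponent m → Poly n
monomialAt ρ α = product (λ i → ρ i ^ lookup α i)

infixl 9 _⟦_⟧
_⟦_⟧ : Poly m → (Fin m → Poly n) → Poly n
[]            ⟦ ρ ⟧ = 0ₚ
((c , α) ∷ f) ⟦ ρ ⟧ = constₚ c *ₚ monomialAt ρ α +ₚ f ⟦ ρ ⟧

Symmetric : Poly n → Set
Symmetric {n} f = (σ : Permutation′ n) → f ⟦ (λ i → var (σ ⟨$⟩ʳ i)) ⟧ ≈ f

Homogeneous : ℕ → Poly n → Set
Homogeneous r f = ∀ α → coeff f α ≢ 0ℤ → degree α ≡ r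

setZero : ∀ n p → Fin (n ℕ.+ p) → Poly n
setZero n p i = [ var , const 0ₚ ]′ (splitAt n i)

-- The additive functional sending the monomial with exponent α to φ α.
-- Coefficients are of this form, and it respects _≈_.
Lin : (Exponent n → ℤ) → Poly n → ℤ
Lin φ []            = 0ℤ
Lin φ ((c , α) ∷ f) = c ℤ.* φ α ℤ.+ Lin φ f

δ : Exponent n → Exponent n → ℤ
δ α β = if does (β ≟ₑ α) then 1ℤ else 0ℤ

coeff≡Lin : ∀ (f : Poly n) α → coeff f α ≡ Lin (δ α) f
coeff≡Lin []            α = refl
coeff≡Lin ((c , β) ∷ f) α with β ≟ₑ α
... | yes _ = cong₂ ℤ._+_ (sym (ℤ.*-identityʳ c)) (coeff≡Lin f α)
... | no  _ = cong₂ ℤ._+_ (sym (ℤ.*-zeroʳ c)) (coeff≡Lin f α)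

private
  sumOver : List (Exponent n) → (Exponent n → ℤ) → ℤ
  sumOver []      ψ = 0ℤ
  sumOver (α ∷ S) ψ = ψ α ℤ.+ sumOver S ψ

  sumOver-cong : ∀ (S : List (Exponent n)) {φ ψ} → (∀ α → φ α ≡ ψ α) → sumOver S φ ≡ sumOver S ψ
  sumOver-cong []      eq = refl
  sumOver-cong (α ∷ S) eq = cong₂ ℤ._+_ (eq α) (sumOver-cong S eq)

  sumOver-0 : ∀ (S : List (Exponent n)) {φ} → All (λ α → φ α ≡ 0ℤ) S → sumOver S φ ≡ 0ℤ
  sumOver-0 []      []        = refl
  sumOver-0 (α ∷ S) (eq ∷ eqs) = cong₂ ℤ._+_ eq (sumOver-0 S eqs)

  sumOver-+ : ∀ (S : List (Exponent n)) φ ψ →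
              sumOver S (λ α → φ α ℤ.+ ψ α) ≡ sumOver S φ ℤ.+ sumOver S ψ
  sumOver-+ []      φ ψ = refl
  sumOver-+ (α ∷ S) φ ψ rewrite sumOver-+ S φ ψ = lemma (φ α) (ψ α) (sumOver S φ) (sumOver S ψ)
    where
    lemma : ∀ a b c d → (a ℤ.+ b) ℤ.+ (c ℤ.+ d) ≡ (a ℤ.+ c) ℤ.+ (b ℤ.+ d)
    lemma = solve-∀

  termAt : ℤ → Exponent n → (Exponent n → ℤ) → Exponent n → ℤ
  termAt c β φ α = (if does (β ≟ₑ α) then c else 0ℤ) ℤ.* φ α

  termAt-same : ∀ c (β : Exponent n) φ → termAt c β φ β ≡ c ℤ.* φ β
  termAt-same c β φ with β ≟ₑ β
  ... | yes _   = refl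
  ... | no  β≢β = contradiction refl β≢β

  termAt-other : ∀ c {α β : Exponent n} φ → β ≢ α → termAt c β φ α ≡ 0ℤ
  termAt-other c {α} {β} φ β≢α with β ≟ₑ α
  ... | yes β≡α = contradiction β≡α β≢α
  ... | no  _   = refl

  sumOver-pick : ∀ {S : List (Exponent n)} c {β} φ → Unique S → β ∈ S →
                 sumOver S (termAt c β φ) ≡ c ℤ.* φ β
  sumOver-pick {S = β ∷ S} c φ (β∉S ∷ _) (here refl) =
    trans (cong₂ ℤ._+_ (termAt-same c β φ) (sumOver-0 S (All.map (termAt-other c φ) β∉S)))
          (ℤ.+-identityʳ _)
  sumOver-pick {S = α ∷ S} c φ (α∉S ∷ uniq) (there β∈S) =
    trans (cong₂ ℤ._+_ (termAt-other c φ (λ β≡α → All.lookup α∉S β∈S (sym β≡α)))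
                       (sumOver-pick c φ uniq β∈S))
          (ℤ.+-identityˡ _)

  Lin-sumOver : ∀ {S : List (Exponent n)} φ (f : Poly n) → Unique S →
                (∀ {t} → t ∈ f → proj₂ t ∈ S) →
                Lin φ f ≡ sumOver S (λ α → coeff f α ℤ.* φ α)
  Lin-sumOver {S = S} φ [] uniq supp = sym (sumOver-0 S (All.tabulate (λ _ → refl)))
  Lin-sumOver {S = S} φ ((c , β) ∷ f) uniq supp = begin
    c ℤ.* φ β ℤ.+ Lin φ f
      ≡⟨ cong₂ ℤ._+_ (sym (sumOver-pick c φ uniq (supp (here refl))))
                     (Lin-sumOver φ f uniq (supp ∘ there)) ⟩
    sumOver S (termAt c β φ) ℤ.+ sumOver S (λ α → coeff f α ℤ.* φ α)
      ≡⟨ sumOver-+ S _ _ ⟨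
    sumOver S (λ α → termAt c β φ α ℤ.+ coeff f α ℤ.* φ α)
      ≡⟨ sumOver-cong S (λ α → sym (ℤ.*-distribʳ-+ (φ α) (if does (β ≟ₑ α) then c else 0ℤ) (coeff f α))) ⟩
    sumOver S (λ α → coeff ((c , β) ∷ f) α ℤ.* φ α) ∎
    where open ≡-Reasoning

  ∈-map-proj₂ : ∀ {t : Term n} {f : Poly n} → t ∈ f → proj₂ t ∈ List.map proj₂ f
  ∈-map-proj₂ (here refl) = here refl
  ∈-map-proj₂ (there t∈f) = there (∈-map-proj₂ t∈f)

Lin-≈ : ∀ {f g : Poly n} φ → f ≈ g → Lin φ f ≡ Lin φ g
Lin-≈ {f = f} {g} φ f≈g = begin
  Lin φ f
    ≡⟨ Lin-sumOver φ f uniq (λ t∈f → ∈-deduplicate⁺ _≟ₑ_ (∈-++⁺ˡ (∈-map-proj₂ t∈f))) ⟩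
  sumOver S (λ α → coeff f α ℤ.* φ α)
    ≡⟨ sumOver-cong S (λ α → cong (ℤ._* φ α) (coeff-≡ f≈g α)) ⟩
  sumOver S (λ α → coeff g α ℤ.* φ α)
    ≡⟨ Lin-sumOver φ g uniq (λ t∈g → ∈-deduplicate⁺ _≟ₑ_ (∈-++⁺ʳ _ (∈-map-proj₂ t∈g))) ⟨
  Lin φ g ∎
  where
  open ≡-Reasoning
  all  = List.map proj₂ f ++ List.map proj₂ g
  S    = deduplicate _≟ₑ_ all
  uniq = deduplicate-! _≟ₑ_ all

Lin-cong : ∀ (f : Poly n) {φ ψ} → (∀ α → φ α ≡ ψ α) → Lin φ f ≡ Lin ψ f
Lin-cong []            eq = refl
Lin-cong ((c , α) ∷ f) eq = cong₂ ℤ._+_ (cong (c ℤ.*_) (eq α)) (Lin-cong f eq)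

Lin⇒≈ : ∀ {f g : Poly n} → (∀ φ → Lin φ f ≡ Lin φ g) → f ≈ g
Lin⇒≈ {f = f} {g} eq =
  mk≈ λ α → trans (coeff≡Lin f α) (trans (eq (δ α)) (sym (coeff≡Lin g α)))

Lin-+ : ∀ φ (f g : Poly n) → Lin φ (f +ₚ g) ≡ Lin φ f ℤ.+ Lin φ g
Lin-+ φ []            g = sym (ℤ.+-identityˡ _)
Lin-+ φ ((c , α) ∷ f) g rewrite Lin-+ φ f g = sym (ℤ.+-assoc (c ℤ.* φ α) _ _)

Lin-neg : ∀ φ (f : Poly n) → Lin φ (-ₚ f) ≡ ℤ.- Lin φ f
Lin-neg φ []            = refl
Lin-neg φ ((c , α) ∷ f) rewrite Lin-neg φ f = lemma c (φ α) (Lin φ f)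
  where
  lemma : ∀ a b d → (ℤ.- a) ℤ.* b ℤ.+ ℤ.- d ≡ ℤ.- (a ℤ.* b ℤ.+ d)
  lemma = solve-∀

Lin-⊗ : ∀ φ c α (g : Poly n) →
        Lin φ (List.map ((c , α) ⊗_) g) ≡ c ℤ.* Lin (λ β → φ (zipWith ℕ._+_ α β)) g
Lin-⊗ φ c α []            = sym (ℤ.*-zeroʳ c)
Lin-⊗ φ c α ((d , β) ∷ g) rewrite Lin-⊗ φ c α g = lemma c d (φ (zipWith ℕ._+_ α β)) _
  where
  lemma : ∀ a b x y → (a ℤ.* b) ℤ.* x ℤ.+ a ℤ.* y ≡ a ℤ.* (b ℤ.* x ℤ.+ y)
  lemma = solve-∀

Lin-* : ∀ φ (f g : Poly n) →
        Lin φ (f *ₚ g) ≡ Lin (λ α → Lin (λ β → φ (zipWith ℕ._+_ α β)) g) f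
Lin-* φ []            g = refl
Lin-* φ ((c , α) ∷ f) g =
  trans (Lin-+ φ (List.map ((c , α) ⊗_) g) (f *ₚ g)) (cong₂ ℤ._+_ (Lin-⊗ φ c α g) (Lin-* φ f g))

private
  Lin-+-fun : ∀ (f : Poly n) c φ ψ → Lin (λ α → c ℤ.* φ α ℤ.+ ψ α) f ≡ c ℤ.* Lin φ f ℤ.+ Lin ψ f
  Lin-+-fun []            c φ ψ = sym (trans (ℤ.+-identityʳ _) (ℤ.*-zeroʳ c))
  Lin-+-fun ((d , α) ∷ f) c φ ψ rewrite Lin-+-fun f c φ ψ =
    lemma d c (φ α) (ψ α) (Lin φ f) (Lin ψ f)
    where
    lemma : ∀ d c x y u v → d ℤ.* (c ℤ.* x ℤ.+ y) ℤ.+ (c ℤ.* u ℤ.+ v)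
                          ≡ c ℤ.* (d ℤ.* x ℤ.+ u) ℤ.+ (d ℤ.* y ℤ.+ v)
    lemma = solve-∀

  Lin-0-fun : ∀ (f : Poly n) → Lin (λ _ → 0ℤ) f ≡ 0ℤ
  Lin-0-fun []            = refl
  Lin-0-fun ((c , α) ∷ f) rewrite Lin-0-fun f = trans (ℤ.+-identityʳ _) (ℤ.*-zeroʳ c)

Lin-swap : ∀ (f : Poly m) (g : Poly n) (ψ : Exponent m → Exponent n → ℤ) →
           Lin (λ α → Lin (λ β → ψ α β) g) f ≡ Lin (λ β → Lin (λ α → ψ α β) f) g
Lin-swap []            g ψ = sym (Lin-0-fun g)
Lin-swap ((c , α) ∷ f) g ψ =
  trans (cong (λ z → c ℤ.* Lin (ψ α) g ℤ.+ z) (Lin-swap f g ψ))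
        (sym (Lin-+-fun g c (ψ α) _))

≈-isEquivalence : IsEquivalence (_≈_ {n})
≈-isEquivalence = record
  { refl  = mk≈ λ _ → refl
  ; sym   = λ (mk≈ e) → mk≈ λ α → sym (e α)
  ; trans = λ (mk≈ d) (mk≈ e) → mk≈ λ α → trans (d α) (e α)
  }

private
  +-cong : ∀ {f f′ g g′ : Poly n} → f ≈ f′ → g ≈ g′ → f +ₚ g ≈ f′ +ₚ g′
  +-cong {f = f} {f′} {g} {g′} e d = Lin⇒≈ λ φ →
    trans (Lin-+ φ f g) (trans (cong₂ ℤ._+_ (Lin-≈ φ e) (Lin-≈ φ d)) (sym (Lin-+ φ f′ g′)))

  +-assoc : ∀ (f g h : Poly n) → (f +ₚ g) +ₚ h ≈ f +ₚ (g +ₚ h)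
  +-assoc f g h = Lin⇒≈ λ φ → begin
    Lin φ ((f +ₚ g) +ₚ h)                   ≡⟨ Lin-+ φ (f +ₚ g) h ⟩
    Lin φ (f +ₚ g) ℤ.+ Lin φ h              ≡⟨ cong (ℤ._+ Lin φ h) (Lin-+ φ f g) ⟩
    (Lin φ f ℤ.+ Lin φ g) ℤ.+ Lin φ h       ≡⟨ ℤ.+-assoc (Lin φ f) _ _ ⟩
    Lin φ f ℤ.+ (Lin φ g ℤ.+ Lin φ h)       ≡⟨ cong (λ z → Lin φ f ℤ.+ z) (Lin-+ φ g h) ⟨
    Lin φ f ℤ.+ Lin φ (g +ₚ h)              ≡⟨ Lin-+ φ f (g +ₚ h) ⟨
    Lin φ (f +ₚ (g +ₚ h)) ∎
    where open ≡-Reasoning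

  +-comm : ∀ (f g : Poly n) → f +ₚ g ≈ g +ₚ f
  +-comm f g = Lin⇒≈ λ φ → trans (Lin-+ φ f g) (trans (ℤ.+-comm (Lin φ f) _) (sym (Lin-+ φ g f)))

  +-identityˡ : ∀ (f : Poly n) → 0ₚ +ₚ f ≈ f
  +-identityˡ f = mk≈ λ _ → refl

  +-identityʳ : ∀ (f : Poly n) → f +ₚ 0ₚ ≈ f
  +-identityʳ f = Lin⇒≈ λ φ → trans (Lin-+ φ f 0ₚ) (ℤ.+-identityʳ _)

  neg-cong : ∀ {f g : Poly n} → f ≈ g → -ₚ f ≈ -ₚ g
  neg-cong {f = f} {g} e = Lin⇒≈ λ φ →
    trans (Lin-neg φ f) (trans (cong ℤ.-_ (Lin-≈ φ e)) (sym (Lin-neg φ g)))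

  neg-inverseʳ : ∀ (f : Poly n) → f +ₚ -ₚ f ≈ 0ₚ
  neg-inverseʳ f = Lin⇒≈ λ φ →
    trans (Lin-+ φ f (-ₚ f))
          (trans (cong (λ z → Lin φ f ℤ.+ z) (Lin-neg φ f)) (ℤ.+-inverseʳ (Lin φ f)))

  neg-inverseˡ : ∀ (f : Poly n) → -ₚ f +ₚ f ≈ 0ₚ
  neg-inverseˡ f = IsEquivalence.trans ≈-isEquivalence (+-comm (-ₚ f) f) (neg-inverseʳ f)

  *-cong : ∀ {f f′ g g′ : Poly n} → f ≈ f′ → g ≈ g′ → f *ₚ g ≈ f′ *ₚ g′
  *-cong {f = f} {f′} {g} {g′} e d = Lin⇒≈ λ φ →
    trans (Lin-* φ f g) (trans (Lin-≈ _ e)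
      (trans (Lin-cong f′ (λ α → Lin-≈ _ d)) (sym (Lin-* φ f′ g′))))

  *-comm : ∀ (f g : Poly n) → f *ₚ g ≈ g *ₚ f
  *-comm f g = Lin⇒≈ λ φ → begin
    Lin φ (f *ₚ g)                                        ≡⟨ Lin-* φ f g ⟩
    Lin (λ α → Lin (λ β → φ (zipWith ℕ._+_ α β)) g) f     ≡⟨ Lin-swap f g (λ α β → φ (zipWith ℕ._+_ α β)) ⟩
    Lin (λ β → Lin (λ α → φ (zipWith ℕ._+_ α β)) f) g
      ≡⟨ Lin-cong g (λ β → Lin-cong f (λ α → cong φ (Vec.zipWith-comm ℕ.+-comm α β))) ⟩
    Lin (λ β → Lin (λ α → φ (zipWith ℕ._+_ β α)) f) g     ≡⟨ Lin-* φ g f ⟨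
    Lin φ (g *ₚ f) ∎
    where open ≡-Reasoning

  *-assoc : ∀ (f g h : Poly n) → (f *ₚ g) *ₚ h ≈ f *ₚ (g *ₚ h)
  *-assoc f g h = Lin⇒≈ λ φ → begin
    Lin φ ((f *ₚ g) *ₚ h)
      ≡⟨ trans (Lin-* φ (f *ₚ g) h) (Lin-* _ f g) ⟩
    Lin (λ α → Lin (λ β → Lin (λ γ → φ (zipWith ℕ._+_ (zipWith ℕ._+_ α β) γ)) h) g) f
      ≡⟨ Lin-cong f (λ α → Lin-cong g (λ β → Lin-cong h (λ γ →
           cong φ (Vec.zipWith-assoc ℕ.+-assoc α β γ)))) ⟩
    Lin (λ α → Lin (λ β → Lin (λ γ → φ (zipWith ℕ._+_ α (zipWith ℕ._+_ β γ))) h) g) f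
      ≡⟨ Lin-cong f (λ α → Lin-* _ g h) ⟨
    Lin (λ α → Lin (λ β → φ (zipWith ℕ._+_ α β)) (g *ₚ h)) f
      ≡⟨ Lin-* φ f (g *ₚ h) ⟨
    Lin φ (f *ₚ (g *ₚ h)) ∎
    where open ≡-Reasoning

  *-distribʳ : ∀ (h f g : Poly n) → (f +ₚ g) *ₚ h ≈ f *ₚ h +ₚ g *ₚ h
  *-distribʳ h f g = Lin⇒≈ λ φ → begin
    Lin φ ((f +ₚ g) *ₚ h)                     ≡⟨ trans (Lin-* φ (f +ₚ g) h) (Lin-+ _ f g) ⟩
    Lin _ f ℤ.+ Lin _ g                       ≡⟨ cong₂ ℤ._+_ (Lin-* φ f h) (Lin-* φ g h) ⟨
    Lin φ (f *ₚ h) ℤ.+ Lin φ (g *ₚ h)         ≡⟨ Lin-+ φ (f *ₚ h) (g *ₚ h) ⟨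
    Lin φ (f *ₚ h +ₚ g *ₚ h) ∎
    where open ≡-Reasoning

  Lin-const-* : ∀ φ c (f : Poly n) → Lin φ (constₚ c *ₚ f) ≡ c ℤ.* Lin φ f
  Lin-const-* φ c f = trans (Lin-* φ (constₚ c) f) (trans (ℤ.+-identityʳ _)
    (cong (c ℤ.*_) (Lin-cong f (λ β → cong φ (Vec.zipWith-identityˡ ℕ.+-identityˡ β)))))

  *-identityˡ : ∀ (f : Poly n) → 1ₚ *ₚ f ≈ f
  *-identityˡ f = Lin⇒≈ λ φ → trans (Lin-const-* φ 1ℤ f) (ℤ.*-identityˡ _)

polyRing : ℕ → CommutativeRing 0ℓ 0ℓ
polyRing n = record
  { RawRing (rawPolyRing n)
  ; isCommutativeRing = record
    { isRing = record
      { +-isAbelianGroup = record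
        { isGroup = record
          { isMonoid = record
            { isSemigroup = record
              { isMagma = record { isEquivalence = ≈-isEquivalence ; ∙-cong = +-cong }
              ; assoc   = +-assoc
              }
            ; identity = +-identityˡ , +-identityʳ
            }
          ; inverse = neg-inverseˡ , neg-inverseʳ
          ; ⁻¹-cong = neg-cong
          }
        ; comm = +-comm
        }
      ; *-cong     = *-cong
      ; *-assoc    = *-assoc
      ; *-identity = *-identityˡ , λ f → ≈-trans (*-comm f 1ₚ) (*-identityˡ f)
      ; distrib    = (λ h f g → ≈-trans (*-comm h (f +ₚ g))
                       (≈-trans (*-distribʳ h f g) (+-cong (*-comm f h) (*-comm g h))))
                   , *-distribʳ
      }
    ; *-comm = *-comm
    }
  }
  where open IsEquivalence (≈-isEquivalence {n}) using () renaming (trans to ≈-trans)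

private
  module P {n} = CommutativeRing (polyRing n)
  module PExp {n} = Exp (P.semiring {n})
  module PProd {n} = CMSum (P.*-commutativeMonoid {n})

  open P using () renaming (refl to ≈-refl; sym to ≈-sym; trans to ≈-trans; reflexive to ≈-reflexive)

  product-cong : ∀ {u v : Fin m → Poly n} → (∀ i → u i ≈ v i) → product u ≈ product v
  product-cong {u = u} {v} = PProd.sum-cong-≋ {x = u} {y = v}

Lin-⟦⟧ : ∀ φ (f : Poly m) (ρ : Fin m → Poly n) → Lin φ (f ⟦ ρ ⟧) ≡ Lin (λ α → Lin φ (monomialAt ρ α)) f
Lin-⟦⟧ φ []            ρ = refl
Lin-⟦⟧ φ ((c , α) ∷ f) ρ =
  trans (Lin-+ φ (constₚ c *ₚ monomialAt ρ α) (f ⟦ ρ ⟧))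
        (cong₂ ℤ._+_ (Lin-const-* φ c (monomialAt ρ α)) (Lin-⟦⟧ φ f ρ))

⟦⟧-cong : ∀ {f g : Poly m} (ρ : Fin m → Poly n) → f ≈ g → f ⟦ ρ ⟧ ≈ g ⟦ ρ ⟧
⟦⟧-cong {f = f} {g} ρ e = Lin⇒≈ λ φ → trans (Lin-⟦⟧ φ f ρ) (trans (Lin-≈ _ e) (sym (Lin-⟦⟧ φ g ρ)))

monomialAt-cong : ∀ {ρ τ : Fin m → Poly n} α → (∀ i → ρ i ≈ τ i) → monomialAt ρ α ≈ monomialAt τ α
monomialAt-cong α e = product-cong (λ i → PExp.^-congˡ (lookup α i) (e i))

⟦⟧-congʳ : ∀ (f : Poly m) {ρ τ : Fin m → Poly n} → (∀ i → ρ i ≈ τ i) → f ⟦ ρ ⟧ ≈ f ⟦ τ ⟧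
⟦⟧-congʳ f {ρ} {τ} e = Lin⇒≈ λ φ →
  trans (Lin-⟦⟧ φ f ρ) (trans (Lin-cong f (λ α → Lin-≈ φ (monomialAt-cong α e))) (sym (Lin-⟦⟧ φ f τ)))

monomialAt-+ : ∀ (ρ : Fin m → Poly n) α β →
               monomialAt ρ (zipWith ℕ._+_ α β) ≈ monomialAt ρ α *ₚ monomialAt ρ β
monomialAt-+ ρ α β = ≈-trans
  (product-cong (λ i → ≈-trans
    (≈-reflexive (cong (ρ i ^_) (Vec.lookup-zipWith ℕ._+_ i α β)))
    (PExp.^-homo-* (ρ i) (lookup α i) (lookup β i))))
  (PProd.∑-distrib-+ (λ i → ρ i ^ lookup α i) (λ i → ρ i ^ lookup β i))

product-1 : ∀ {u : Fin m → Poly n} → (∀ i → u i ≈ 1ₚ) → product u ≈ 1ₚ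
product-1 {zero}  e = ≈-refl
product-1 {suc m} e = ≈-trans (*-cong (e zero) (product-1 (e ∘ suc))) (P.*-identityˡ 1ₚ)

monomialAt-0 : ∀ (ρ : Fin m → Poly n) → monomialAt ρ (replicate m 0) ≈ 1ₚ
monomialAt-0 ρ = product-1 (λ i → ≈-reflexive (cong (ρ i ^_) (Vec.lookup-replicate i 0)))

⟦⟧-const : ∀ c (ρ : Fin m → Poly n) → constₚ c ⟦ ρ ⟧ ≈ constₚ c
⟦⟧-const c ρ = ≈-trans (P.+-identityʳ _)
  (≈-trans (P.*-congˡ {x = constₚ c} (monomialAt-0 ρ)) (P.*-identityʳ (constₚ c)))

⟦⟧-+ : ∀ (f g : Poly m) (ρ : Fin m → Poly n) → (f +ₚ g) ⟦ ρ ⟧ ≈ f ⟦ ρ ⟧ +ₚ g ⟦ ρ ⟧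
⟦⟧-+ f g ρ = Lin⇒≈ λ φ → begin
  Lin φ ((f +ₚ g) ⟦ ρ ⟧)                  ≡⟨ trans (Lin-⟦⟧ φ (f +ₚ g) ρ) (Lin-+ _ f g) ⟩
  Lin _ f ℤ.+ Lin _ g                     ≡⟨ cong₂ ℤ._+_ (Lin-⟦⟧ φ f ρ) (Lin-⟦⟧ φ g ρ) ⟨
  Lin φ (f ⟦ ρ ⟧) ℤ.+ Lin φ (g ⟦ ρ ⟧)     ≡⟨ Lin-+ φ (f ⟦ ρ ⟧) (g ⟦ ρ ⟧) ⟨
  Lin φ (f ⟦ ρ ⟧ +ₚ g ⟦ ρ ⟧) ∎
  where open ≡-Reasoning

⟦⟧-neg : ∀ (f : Poly m) (ρ : Fin m → Poly n) → (-ₚ f) ⟦ ρ ⟧ ≈ -ₚ (f ⟦ ρ ⟧)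
⟦⟧-neg f ρ = Lin⇒≈ λ φ → begin
  Lin φ ((-ₚ f) ⟦ ρ ⟧)      ≡⟨ trans (Lin-⟦⟧ φ (-ₚ f) ρ) (Lin-neg _ f) ⟩
  ℤ.- Lin _ f               ≡⟨ cong ℤ.-_ (Lin-⟦⟧ φ f ρ) ⟨
  ℤ.- Lin φ (f ⟦ ρ ⟧)       ≡⟨ Lin-neg φ (f ⟦ ρ ⟧) ⟨
  Lin φ (-ₚ (f ⟦ ρ ⟧)) ∎
  where open ≡-Reasoning

⟦⟧-* : ∀ (f g : Poly m) (ρ : Fin m → Poly n) → (f *ₚ g) ⟦ ρ ⟧ ≈ f ⟦ ρ ⟧ *ₚ g ⟦ ρ ⟧
⟦⟧-* f g ρ = Lin⇒≈ λ φ → begin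
  Lin φ ((f *ₚ g) ⟦ ρ ⟧)
    ≡⟨ trans (Lin-⟦⟧ φ (f *ₚ g) ρ) (Lin-* _ f g) ⟩
  Lin (λ α → Lin (λ β → Lin φ (monomialAt ρ (zipWith ℕ._+_ α β))) g) f
    ≡⟨ Lin-cong f (λ α → Lin-cong g (λ β →
         trans (Lin-≈ φ (monomialAt-+ ρ α β)) (Lin-* φ (monomialAt ρ α) (monomialAt ρ β)))) ⟩
  Lin (λ α → Lin (λ β → Lin (λ a → Lin (λ b → φ (zipWith ℕ._+_ a b)) (monomialAt ρ β)) (monomialAt ρ α)) g) f
    ≡⟨ Lin-cong f (λ α → Lin-swap g (monomialAt ρ α) (λ β a → Lin (λ b → φ (zipWith ℕ._+_ a b)) (monomialAt ρ β))) ⟩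
  Lin (λ α → Lin (λ a → Lin (λ β → Lin (λ b → φ (zipWith ℕ._+_ a b)) (monomialAt ρ β)) g) (monomialAt ρ α)) f
    ≡⟨ Lin-cong f (λ α → Lin-cong (monomialAt ρ α) (λ a → Lin-⟦⟧ _ g ρ)) ⟨
  Lin (λ α → Lin (λ a → Lin (λ b → φ (zipWith ℕ._+_ a b)) (g ⟦ ρ ⟧)) (monomialAt ρ α)) f
    ≡⟨ Lin-⟦⟧ _ f ρ ⟨
  Lin (λ a → Lin (λ b → φ (zipWith ℕ._+_ a b)) (g ⟦ ρ ⟧)) (f ⟦ ρ ⟧)
    ≡⟨ Lin-* φ (f ⟦ ρ ⟧) (g ⟦ ρ ⟧) ⟨
  Lin φ (f ⟦ ρ ⟧ *ₚ g ⟦ ρ ⟧) ∎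
  where open ≡-Reasoning

⟦⟧-^ : ∀ (f : Poly m) k (ρ : Fin m → Poly n) → (f ^ k) ⟦ ρ ⟧ ≈ (f ⟦ ρ ⟧) ^ k
⟦⟧-^ f zero    ρ = ⟦⟧-const 1ℤ ρ
⟦⟧-^ f (suc k) ρ = ≈-trans (⟦⟧-* f (f ^ k) ρ) (P.*-congˡ {x = f ⟦ ρ ⟧} (⟦⟧-^ f k ρ))

⟦⟧-product : ∀ (u : Fin k → Poly m) (ρ : Fin m → Poly n) → product u ⟦ ρ ⟧ ≈ product (λ i → u i ⟦ ρ ⟧)
⟦⟧-product {zero}  u ρ = ⟦⟧-const 1ℤ ρ
⟦⟧-product {suc k} u ρ =
  ≈-trans (⟦⟧-* (u zero) (product (u ∘ suc)) ρ) (P.*-congˡ {x = u zero ⟦ ρ ⟧} (⟦⟧-product (u ∘ suc) ρ))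

⟦⟧-⟦⟧ : ∀ (f : Poly k) (ρ : Fin k → Poly m) (τ : Fin m → Poly n) →
        f ⟦ ρ ⟧ ⟦ τ ⟧ ≈ f ⟦ (λ i → ρ i ⟦ τ ⟧) ⟧
⟦⟧-⟦⟧ []            ρ τ = ≈-refl
⟦⟧-⟦⟧ ((c , α) ∷ f) ρ τ =
  ≈-trans (⟦⟧-+ (constₚ c *ₚ monomialAt ρ α) (f ⟦ ρ ⟧) τ)
    (P.+-cong
      (≈-trans (⟦⟧-* (constₚ c) (monomialAt ρ α) τ)
        (P.*-cong (⟦⟧-const c τ)
          (≈-trans (⟦⟧-product (λ i → ρ i ^ lookup α i) τ)
            (product-cong (λ i → ⟦⟧-^ (ρ i) (lookup α i) τ)))))
      (⟦⟧-⟦⟧ f ρ τ))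

monomialAt-unit : ∀ (ρ : Fin m → Poly n) i → monomialAt ρ (replicate m 0 [ i ]≔ 1) ≈ ρ i
monomialAt-unit ρ zero =
  ≈-trans (P.*-cong (P.*-identityʳ (ρ zero)) (monomialAt-0 (ρ ∘ suc))) (P.*-identityʳ (ρ zero))
monomialAt-unit ρ (suc i) = ≈-trans (P.*-identityˡ _) (monomialAt-unit (ρ ∘ suc) i)

⟦⟧-var : ∀ (ρ : Fin m → Poly n) i → var i ⟦ ρ ⟧ ≈ ρ i
⟦⟧-var ρ i = ≈-trans (P.+-identityʳ _) (≈-trans (P.*-identityˡ _) (monomialAt-unit ρ i))

SymPoly : ℕ → Set
SymPoly n = Σ (Poly n) Symmetric

rawΛ : ℕ → RawRing 0ℓ 0ℓ
rawΛ n = record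
  { Carrier = SymPoly n
  ; _≈_     = λ f g → proj₁ f ≈ proj₁ g
  ; _+_     = λ (f , f-sym) (g , g-sym) →
                f +ₚ g , λ σ → ≈-trans (⟦⟧-+ f g _) (P.+-cong (f-sym σ) (g-sym σ))
  ; _*_     = λ (f , f-sym) (g , g-sym) →
                f *ₚ g , λ σ → ≈-trans (⟦⟧-* f g _) (P.*-cong (f-sym σ) (g-sym σ))
  ; -_      = λ (f , f-sym) → -ₚ f , λ σ → ≈-trans (⟦⟧-neg f _) (P.-‿cong (f-sym σ))
  ; 0#      = 0ₚ , λ σ → ≈-refl
  ; 1#      = 1ₚ , λ σ → ⟦⟧-const 1ℤ (λ i → var (σ ⟨$⟩ʳ i))
  }

Λ↪poly : ∀ n → IsRingMonomorphism (rawΛ n) (rawPolyRing n) proj₁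
Λ↪poly n = record
  { isRingHomomorphism = record
    { isSemiringHomomorphism = record
      { isNearSemiringHomomorphism = record
        { +-isMonoidHomomorphism = record
          { isMagmaHomomorphism = record
            { isRelHomomorphism = record { cong = λ e → e }
            ; homo              = λ _ _ → ≈-refl
            }
          ; ε-homo = ≈-refl
          }
        ; *-homo = λ _ _ → ≈-refl
        }
      ; 1#-homo = ≈-refl
      }
    ; -‿homo = λ _ → ≈-refl
    }
  ; injective = λ e → e
  }

Λ : ℕ → CommutativeRing 0ℓ 0ℓ
Λ n = record
  { RawRing (rawΛ n)
  ; isCommutativeRing =
      RingMono.isCommutativeRing (Λ↪poly n) (CommutativeRing.isCommutativeRing (polyRing n))
  }

coeff-+ : ∀ (f g : Poly n) α → coeff (f +ₚ g) α ≡ coeff f α ℤ.+ coeff g α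
coeff-+ f g α = trans (coeff≡Lin (f +ₚ g) α) (trans (Lin-+ (δ α) f g)
  (sym (cong₂ ℤ._+_ (coeff≡Lin f α) (coeff≡Lin g α))))

coeff-neg : ∀ (f : Poly n) α → coeff (-ₚ f) α ≡ ℤ.- coeff f α
coeff-neg f α = trans (coeff≡Lin (-ₚ f) α) (trans (Lin-neg (δ α) f)
  (sym (cong ℤ.-_ (coeff≡Lin f α))))

Homogeneous-+ : ∀ {f g : Poly n} → Homogeneous r f → Homogeneous r g → Homogeneous r (f +ₚ g)
Homogeneous-+ {f = f} {g} f-hom g-hom α c≢0 with coeff f α ℤ.≟ 0ℤ
... | no  cf≢0 = f-hom α cf≢0
... | yes cf≡0 = g-hom α λ cg≡0 → c≢0 (trans (coeff-+ f g α) (cong₂ ℤ._+_ cf≡0 cg≡0))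

Homogeneous-neg : ∀ {f : Poly n} → Homogeneous r f → Homogeneous r (-ₚ f)
Homogeneous-neg {f = f} f-hom α c≢0 =
  f-hom α λ cf≡0 → c≢0 (trans (coeff-neg f α) (cong ℤ.-_ cf≡0))

rawΛʳ : ℕ → ℕ → RawGroup 0ℓ 0ℓ
rawΛʳ n r = record
  { Carrier = Σ (SymPoly n) (λ f → Homogeneous r (proj₁ f))
  ; _≈_     = λ f g → proj₁ f L.≈ proj₁ g
  ; _∙_     = λ (f , f-hom) (g , g-hom) →
                f L.+ g , Homogeneous-+ {f = proj₁ f} {proj₁ g} f-hom g-hom
  ; ε       = L.0# , λ α c≢0 → contradiction refl c≢0
  ; _⁻¹     = λ (f , f-hom) → L.- f , Homogeneous-neg {f = proj₁ f} f-hom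
  }
  where module L = CommutativeRing (Λ n)

Λʳ↪Λ : ∀ n r → IsGroupMonomorphism (rawΛʳ n r) (RawRing.+-rawGroup (rawΛ n)) proj₁
Λʳ↪Λ n r = record
  { isGroupHomomorphism = record
    { isMonoidHomomorphism = record
      { isMagmaHomomorphism = record
        { isRelHomomorphism = record { cong = λ e → e }
        ; homo              = λ _ _ → ≈-refl
        }
      ; ε-homo = ≈-refl
      }
    ; ⁻¹-homo = λ _ → ≈-refl
    }
  ; injective = λ e → e
  }

Λʳ : ℕ → ℕ → AbelianGroup 0ℓ 0ℓ
Λʳ n r = record
  { RawGroup (rawΛʳ n r)
  ; isAbelianGroup =
      GroupMono.isAbelianGroup (Λʳ↪Λ n r) (CommutativeRing.+-isAbelianGroup (Λ n))
  }

private
  -- A permutation of the first n indices, fixing the last p.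
  extend : ∀ p → Permutation′ n → Permutation′ (n ℕ.+ p)
  extend {n} p σ = Compose.inverse (+↔⊎ {n} {p}) (Compose.inverse (σ ⊎-↔ ↔-id (Fin p)) (↔-sym +↔⊎))

  setZero-extend : ∀ p (σ : Permutation′ n) i →
    setZero n p i ⟦ (λ j → var (σ ⟨$⟩ʳ j)) ⟧ ≈ setZero n p (extend p σ ⟨$⟩ʳ i)
  setZero-extend {n} p σ i with splitAt n i
  ... | inj₁ j rewrite splitAt-↑ˡ n (σ ⟨$⟩ʳ j) p = ⟦⟧-var (λ j → var (σ ⟨$⟩ʳ j)) j
  ... | inj₂ j rewrite splitAt-↑ʳ n p j = ≈-refl

setZero-symmetric : ∀ n p (f : Poly (n ℕ.+ p)) → Symmetric f → Symmetric (f ⟦ setZero n p ⟧)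
setZero-symmetric n p f f-sym σ =
  ≈-trans (⟦⟧-⟦⟧ f (setZero n p) _)
  (≈-trans (⟦⟧-congʳ f (λ i → ≈-trans (setZero-extend p σ i) (≈-sym (⟦⟧-var (setZero n p) _))))
  (≈-trans (≈-sym (⟦⟧-⟦⟧ f (λ i → var (extend p σ ⟨$⟩ʳ i)) (setZero n p)))
  (⟦⟧-cong (setZero n p) (f-sym (extend p σ)))))

Π : ∀ n p → SymPoly (n ℕ.+ p) → SymPoly n
Π n p (f , f-sym) = f ⟦ setZero n p ⟧ , setZero-symmetric n p f f-sym

private
  product-++ : ∀ m k (u : Fin (m ℕ.+ k) → Poly n) →
               product u ≈ product (λ i → u (i ↑ˡ k)) *ₚ product (λ j → u (m ↑ʳ j))
  product-++ zero    k u = ≈-sym (P.*-identityˡ _)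
  product-++ (suc m) k u =
    ≈-trans (P.*-congˡ {x = u zero} (product-++ m k (u ∘ suc)))
      (≈-sym (P.*-assoc (u zero) (product (λ i → u (suc i ↑ˡ k))) (product (λ j → u (suc m ↑ʳ j)))))

  monomial : Exponent n → Poly n
  monomial α = (1ℤ , α) ∷ []

  scale : ℕ → Exponent n → Exponent n
  scale k = Vec.map (k ℕ.*_)

  vsum : (Fin m → Exponent n) → Exponent n
  vsum {zero}  v = replicate _ 0
  vsum {suc m} v = zipWith ℕ._+_ (v zero) (vsum (v ∘ suc))

  zipWith-scale : ∀ k (α : Exponent n) → zipWith ℕ._+_ α (scale k α) ≡ scale (suc k) α
  zipWith-scale k []      = refl
  zipWith-scale k (a ∷ α) = cong (_ ∷_) (zipWith-scale k α)

  scale-0 : ∀ (α : Exponent n) → scale 0 α ≡ replicate n 0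
  scale-0 []      = refl
  scale-0 (a ∷ α) = cong (0 ∷_) (scale-0 α)

  monomial-^ : ∀ (α : Exponent n) k → monomial α ^ k ≡ monomial (scale k α)
  monomial-^ α zero    = cong monomial (sym (scale-0 α))
  monomial-^ α (suc k) =
    trans (cong (monomial α *ₚ_) (monomial-^ α k)) (cong monomial (zipWith-scale k α))

  product-monomial : ∀ (v : Fin m → Exponent n) → product (λ i → monomial (v i)) ≡ monomial (vsum v)
  product-monomial {zero}  v = refl
  product-monomial {suc m} v = cong (monomial (v zero) *ₚ_) (product-monomial (v ∘ suc))

  vsum-suc : ∀ (a : Fin m → ℕ) (v : Fin m → Exponent n) →
             vsum (λ i → scale (a i) (0 ∷ v i)) ≡ 0 ∷ vsum (λ i → scale (a i) (v i))
  vsum-suc {zero}  a v = refl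
  vsum-suc {suc m} a v rewrite vsum-suc (a ∘ suc) (v ∘ suc) | ℕ.*-zeroʳ (a zero) = refl

  scale-replicate : ∀ k n → scale k (replicate n 0) ≡ replicate n 0
  scale-replicate k n = trans (Vec.map-replicate (k ℕ.*_) 0 n) (cong (replicate n) (ℕ.*-zeroʳ k))

  vsum-unit : ∀ (α : Exponent n) → vsum (λ i → scale (lookup α i) (replicate n 0 [ i ]≔ 1)) ≡ α
  vsum-unit []      = refl
  vsum-unit {suc n} (a ∷ α)
    rewrite vsum-suc (lookup α) (λ i → replicate n 0 [ i ]≔ 1)
          | vsum-unit α | scale-replicate a n =
    cong₂ _∷_ (trans (ℕ.+-identityʳ _) (ℕ.*-identityʳ a)) (Vec.zipWith-identityˡ ℕ.+-identityˡ α)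

  product-cong-≡ : ∀ {u v : Fin m → Poly n} → (∀ i → u i ≡ v i) → product u ≡ product v
  product-cong-≡ {zero}  e = refl
  product-cong-≡ {suc m} e = cong₂ _*ₚ_ (e zero) (product-cong-≡ (e ∘ suc))

monomialAt-var : ∀ (α : Exponent n) → monomialAt var α ≡ (1ℤ , α) ∷ []
monomialAt-var {n} α =
  trans (product-cong-≡ (λ i → monomial-^ (replicate n 0 [ i ]≔ 1) (lookup α i)))
    (trans (product-monomial (λ i → scale (lookup α i) (replicate n 0 [ i ]≔ 1))) (cong monomial (vsum-unit α)))

private
  0^ : ∀ (β : Exponent p) → β ≢ replicate p 0 → monomialAt {n = n} (const 0ₚ) β ≈ 0ₚ
  0^ []          β≢0 = contradiction refl β≢0
  0^ (zero ∷ β)  β≢0 = ≈-trans (P.*-identityˡ _) (0^ β (β≢0 ∘ cong (0 ∷_)))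
  0^ (suc b ∷ β) β≢0 = ≈-refl

  monomialAt-setZero : ∀ n p (α : Exponent n) (β : Exponent p) →
    monomialAt (setZero n p) (α Vec.++ β) ≈ monomial α *ₚ monomialAt (const 0ₚ) β
  monomialAt-setZero n p α β =
    ≈-trans (product-++ n p _)
      (P.*-cong
        (≈-trans (product-cong (λ i → ≈-reflexive (cong₂ _^_
                   (cong [ var , const 0ₚ ]′ (splitAt-↑ˡ n i p)) (Vec.lookup-++ˡ α β i))))
                 (≈-reflexive (monomialAt-var α)))
        (product-cong (λ j → ≈-reflexive (cong₂ _^_
                   (cong [ var , const 0ₚ ]′ (splitAt-↑ʳ n p j)) (Vec.lookup-++ʳ α β j)))))

  coeff-monomial : ∀ (α γ : Exponent n) → coeff (monomial α) γ ≡ δ γ α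
  coeff-monomial α γ = ℤ.+-identityʳ _

  δ-++ : ∀ (γ α : Exponent n) (β : Exponent p) → β ≡ replicate p 0 →
         δ γ α ≡ δ (γ Vec.++ replicate p 0) (α Vec.++ β)
  δ-++ {p = p} γ α β refl with α ≟ₑ γ | (α Vec.++ replicate p 0) ≟ₑ (γ Vec.++ replicate p 0)
  ... | yes _    | yes _ = refl
  ... | no  _    | no  _ = refl
  ... | yes refl | no  ≢ = contradiction refl ≢
  ... | no  α≢γ  | yes e = contradiction (Vec.++-injectiveˡ α γ e) α≢γ

  coeff-monomialAt-setZero : ∀ n p (α : Exponent n) (β : Exponent p) γ →
    coeff (monomialAt (setZero n p) (α Vec.++ β)) γ ≡ δ (γ Vec.++ replicate p 0) (α Vec.++ β)
  coeff-monomialAt-setZero n p α β γ with β ≟ₑ replicate p 0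
  ... | yes refl = begin
    coeff (monomialAt (setZero n p) (α Vec.++ β)) γ       ≡⟨ coeff-≡ (monomialAt-setZero n p α β) γ ⟩
    coeff (monomial α *ₚ monomialAt (const 0ₚ) β) γ
      ≡⟨ coeff-≡ (P.*-congˡ {x = monomial α} (monomialAt-0 {m = p} (const 0ₚ))) γ ⟩
    coeff (monomial α *ₚ 1ₚ) γ                            ≡⟨ coeff-≡ (P.*-identityʳ (monomial α)) γ ⟩
    coeff (monomial α) γ                                  ≡⟨ coeff-monomial α γ ⟩
    δ γ α                                                 ≡⟨ δ-++ γ α β refl ⟩
    δ (γ Vec.++ replicate p 0) (α Vec.++ β) ∎
    where open ≡-Reasoning
  ... | no β≢0 = trans
    (coeff-≡ (≈-trans (monomialAt-setZero n p α β)
      (≈-trans (P.*-congˡ {x = monomial α} (0^ β β≢0)) (P.zeroʳ (monomial α)))) γ)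
    (sym δ≡0)
    where
    δ≡0 : δ (γ Vec.++ replicate p 0) (α Vec.++ β) ≡ 0ℤ
    δ≡0 with (α Vec.++ β) ≟ₑ (γ Vec.++ replicate p 0)
    ... | yes e = contradiction (Vec.++-injectiveʳ α γ e) β≢0
    ... | no  _ = refl

coeff-setZero : ∀ n p (f : Poly (n ℕ.+ p)) γ →
                coeff (f ⟦ setZero n p ⟧) γ ≡ coeff f (γ Vec.++ replicate p 0)
coeff-setZero n p f γ = begin
  coeff (f ⟦ setZero n p ⟧) γ                              ≡⟨ coeff≡Lin (f ⟦ setZero n p ⟧) γ ⟩
  Lin (δ γ) (f ⟦ setZero n p ⟧)                            ≡⟨ Lin-⟦⟧ (δ γ) f (setZero n p) ⟩
  Lin (λ α → Lin (δ γ) (monomialAt (setZero n p) α)) f     ≡⟨ Lin-cong f step ⟩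
  Lin (δ (γ Vec.++ replicate p 0)) f                       ≡⟨ coeff≡Lin f _ ⟨
  coeff f (γ Vec.++ replicate p 0) ∎
  where
  open ≡-Reasoning
  step : ∀ α → Lin (δ γ) (monomialAt (setZero n p) α) ≡ δ (γ Vec.++ replicate p 0) α
  step α with Vec.splitAt n α
  ... | α₁ , α₂ , refl =
    trans (sym (coeff≡Lin (monomialAt (setZero n p) α) γ)) (coeff-monomialAt-setZero n p α₁ α₂ γ)

private
  degree-++-0 : ∀ (γ : Exponent n) p → degree (γ Vec.++ replicate p 0) ≡ degree γ
  degree-++-0 []      zero    = refl
  degree-++-0 []      (suc p) = degree-++-0 [] p
  degree-++-0 (c ∷ γ) p       = cong (c ℕ.+_) (degree-++-0 γ p)

setZero-homogeneous : ∀ n p (f : Poly (n ℕ.+ p)) → Homogeneous r f → Homogeneous r (f ⟦ setZero n p ⟧)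
setZero-homogeneous n p f f-hom γ c≢0 =
  trans (sym (degree-++-0 γ p))
    (f-hom (γ Vec.++ replicate p 0) (λ c≡0 → c≢0 (trans (coeff-setZero n p f γ) c≡0)))

Πʳ : ∀ n p r → AbelianGroup.Carrier (Λʳ (n ℕ.+ p) r) → AbelianGroup.Carrier (Λʳ n r)
Πʳ n p r (f , f-hom) = Π n p f , setZero-homogeneous n p (proj₁ f) f-hom

{-# OPTIONS --safe #-}
-- A polynomial is symmetric iff each of its coefficients depends only on the
-- multiset of nonzero entries of the exponent, and setting the last p
-- indeterminates to zero keeps exactly the coefficients whose multiset has at
-- most n elements. So a symmetric polynomial in n indeterminates lifts by giving
-- every multiset with more than n elements the coefficient zero. In degree r ≤ n
-- there are no such multisets, so the lift is unique. For r > n the sum of all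
-- monomials of degree r with more than n nonzero exponents spoils injectivity.
module Submission where

open import Defs
open import Algebra.Bundles using (AbelianGroup; CommutativeRing)
import Algebra.Properties.CommutativeMonoid.Sum as CMSum
open import Algebra.Morphism.Structures using (IsGroupIsomorphism; IsRingHomomorphism)
open import Data.Bool.Base using (if_then_else_)
open import Data.Fin.Base using (Fin; zero; suc)
open import Data.Fin.Permutation as Perm using (Permutation′; _⟨$⟩ʳ_; _⟨$⟩ˡ_; _∘ₚ_; cast-id; flip)
open import Data.Integer.Base as ℤ using (ℤ; 0ℤ; 1ℤ)
import Data.Integer.Properties as ℤ
open import Data.List.Base as List using (List; []; _∷_; _++_; length; filter; upTo; cartesianProductWith)
import Data.List.Properties as List
open import Data.List.Membership.Propositional using (_∈_; _∉_)
open import Data.List.Membership.Propositional.Properties using (∈-cartesianProductWith⁺; ∈-upTo⁺)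
open import Data.List.Relation.Binary.Permutation.Propositional
  using (_↭_; ↭⇒↭ₛ; ↭-refl; ↭-sym; ↭-trans; ↭-prep; ↭-reflexive)
open import Data.List.Relation.Binary.Permutation.Propositional.Properties
  using (↭-length; filter-↭; shift; ++⁺ʳ; ++-commutativeMonoid)
open import Data.List.Relation.Binary.Permutation.Homogeneous using (onIndices)
open import Data.List.Relation.Binary.Permutation.Setoid.Properties using (onIndices-lookup)
open import Data.List.Relation.Unary.All as All using ([]; _∷_)
import Data.List.Relation.Unary.All.Properties as All
open import Data.List.Relation.Unary.Any as Any using (here; there)
open import Data.List.Relation.Unary.Unique.Propositional using (Unique; []; _∷_)
import Data.List.Relation.Unary.Unique.Propositional.Properties as Unique
open import Data.Nat.Base using (ℕ; zero; suc; _+_; _≤_; _<_; z≤n; s≤s; _⊔_)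
open import Data.Nat.ListAction using (sum)
open import Data.Nat.ListAction.Properties using (sum-↭)
import Data.Nat.Properties as ℕ
open import Data.Product.Base using (_×_; _,_; proj₁; proj₂; ∃)
open import Data.Vec.Base as Vec using ([]; _∷_; lookup; replicate; tabulate; toList)
import Data.Vec.Properties as Vec
open import Function.Base using (_∘_)
open import Function.Bundles using (_⇔_; mk⇔)
open import Function.Definitions using (Surjective)
open import Relation.Binary.PropositionalEquality
  using (_≡_; _≢_; refl; sym; trans; cong; cong₂; subst; setoid; module ≡-Reasoning)
open import Relation.Nullary using (¬_; Dec; yes; no; contradiction)
open import Relation.Nullary.Decidable using (does-⇔; _×-dec_)

private
  variable
    m n p r : ℕ

-- Coefficients under a permutation of the indeterminates.

permute : Permutation′ m → Exponent m → Exponent m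
permute σ α = tabulate (λ i → lookup α (σ ⟨$⟩ʳ i))

permute-flip : ∀ (σ : Permutation′ m) α → permute σ (permute (flip σ) α) ≡ α
permute-flip σ α = trans
  (Vec.tabulate-cong λ i → trans (Vec.lookup∘tabulate _ (σ ⟨$⟩ʳ i)) (cong (lookup α) (Perm.inverseˡ σ)))
  (Vec.tabulate∘lookup α)

-- x_(σ i)^(α i) over all i is x_j^(α (σ⁻¹ j)) over all j.
monomialAt-permute : ∀ (σ : Permutation′ m) α →
  monomialAt (λ i → var (σ ⟨$⟩ʳ i)) α ≈ monomialAt var (permute (flip σ) α)
monomialAt-permute {m} σ α = P.trans
  (PProd.sum-cong-≋ λ i → P.reflexive (cong (var (σ ⟨$⟩ʳ i) ^_)
    (sym (trans (Vec.lookup∘tabulate _ (σ ⟨$⟩ʳ i)) (cong (lookup α) (Perm.inverseˡ σ))))))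
  (P.sym (PProd.sum-permute (λ j → var j ^ lookup (permute (flip σ) α) j) σ))
  where
  module P = CommutativeRing (polyRing m)
  module PProd = CMSum P.*-commutativeMonoid

-- The substitution carries the monomial with exponent α to the one with exponent
-- `permute (flip σ) α`, and this exponent is γ exactly when α is `permute σ γ`. Hence `δ γ` pulls
-- back to `δ (permute σ γ)`.
coeff-permute : ∀ (σ : Permutation′ m) (f : Poly m) γ →
                coeff (f ⟦ (λ i → var (σ ⟨$⟩ʳ i)) ⟧) γ ≡ coeff f (permute σ γ)
coeff-permute σ f γ = begin
  coeff (f ⟦ ρ ⟧) γ                          ≡⟨ coeff≡Lin (f ⟦ ρ ⟧) γ ⟩
  Lin (δ γ) (f ⟦ ρ ⟧)                        ≡⟨ Lin-⟦⟧ (δ γ) f ρ ⟩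
  Lin (λ α → Lin (δ γ) (monomialAt ρ α)) f   ≡⟨ Lin-cong f step ⟩
  Lin (δ (permute σ γ)) f                    ≡⟨ coeff≡Lin f (permute σ γ) ⟨
  coeff f (permute σ γ)                      ∎
  where
  open ≡-Reasoning
  ρ = λ i → var (σ ⟨$⟩ʳ i)
  step : ∀ α → Lin (δ γ) (monomialAt ρ α) ≡ δ (permute σ γ) α
  step α = begin
    Lin (δ γ) (monomialAt ρ α)                        ≡⟨ Lin-≈ (δ γ) (monomialAt-permute σ α) ⟩
    Lin (δ γ) (monomialAt var (permute (flip σ) α))   ≡⟨ cong (Lin (δ γ)) (monomialAt-var (permute (flip σ) α)) ⟩
    1ℤ ℤ.* δ γ (permute (flip σ) α) ℤ.+ 0ℤ            ≡⟨ trans (ℤ.+-identityʳ _) (ℤ.*-identityˡ _) ⟩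
    δ γ (permute (flip σ) α)                          ≡⟨ cong (if_then 1ℤ else 0ℤ) (does-⇔ (mk⇔
      (λ e → trans (sym (permute-flip σ α)) (cong (permute σ) e))
      (λ e → trans (cong (permute (flip σ)) e) (permute-flip (flip σ) γ)))
      (permute (flip σ) α ≟ₑ γ) (α ≟ₑ permute σ γ)) ⟩
    δ (permute σ γ) α                                 ∎

-- Exponents as lists up to rearrangement.

-- Lists under `_++_` form a commutative monoid up to `_↭_`. There an exponent is the sum of the
-- singletons of its entries, and a finite sum is invariant under permuting its index set.
toList-permute : ∀ (σ : Permutation′ m) α → toList (permute σ α) ↭ toList α
toList-permute σ α = ↭-trans (↭-reflexive (toList-tabulate _))
  (↭-trans (↭-sym (LSum.sum-permute (λ i → lookup α i ∷ []) σ))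
  (↭-reflexive (trans (sym (toList-tabulate (lookup α))) (cong toList (Vec.tabulate∘lookup α)))))
  where
  module LSum = CMSum (++-commutativeMonoid {A = ℕ})
  toList-tabulate : ∀ {m} (u : Fin m → ℕ) → toList (tabulate u) ≡ LSum.sum (λ i → u i ∷ [])
  toList-tabulate {zero}  u = refl
  toList-tabulate {suc m} u = cong (u zero ∷_) (toList-tabulate (u ∘ suc))

lookup-toList : ∀ (α : Exponent m) .(eq : m ≡ length (toList α)) i →
                lookup α i ≡ List.lookup (toList α) (cast-id eq ⟨$⟩ʳ i)
lookup-toList (a ∷ α) eq zero    = refl
lookup-toList (a ∷ α) eq (suc i) = lookup-toList α (ℕ.suc-injective eq) i

-- A rearrangement of lists determines a bijection `π` between their positions; casts on both sides
-- turn it into a permutation of `Fin m`.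
toList-↭⇒permute : ∀ {α β : Exponent m} → toList α ↭ toList β → ∃ λ σ → permute σ β ≡ α
toList-↭⇒permute {m} {α} {β} α↭β =
  (cast-id α-eq ∘ₚ π) ∘ₚ flip (cast-id β-eq) , trans (Vec.tabulate-cong lookup≡) (Vec.tabulate∘lookup α)
  where
  α-eq = sym (Vec.length-toList α)
  β-eq = sym (Vec.length-toList β)
  α↭ₛβ = ↭⇒↭ₛ α↭β
  π    = onIndices α↭ₛβ
  lookup≡ : ∀ i → lookup β (flip (cast-id β-eq) ⟨$⟩ʳ (π ⟨$⟩ʳ (cast-id α-eq ⟨$⟩ʳ i))) ≡ lookup α i
  lookup≡ i = trans (lookup-toList β β-eq _)
    (trans (cong (List.lookup (toList β)) (Perm.inverseʳ (cast-id β-eq)))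
    (trans (sym (onIndices-lookup (setoid ℕ) α↭ₛβ (cast-id α-eq ⟨$⟩ʳ i)))
      (sym (lookup-toList α α-eq i))))

-- The multiset of nonzero entries.

nonzeros : Exponent m → List ℕ
nonzeros α = filter ℕ.nonZero? (toList α)

toList-↭-nonzeros : ∀ (α : Exponent m) → ∃ λ k → toList α ↭ nonzeros α ++ List.replicate k 0
toList-↭-nonzeros []          = 0 , ↭-refl
toList-↭-nonzeros (zero ∷ α)  with toList-↭-nonzeros α
... | k , e = suc k , ↭-trans (↭-prep 0 e) (↭-sym (shift 0 (nonzeros α) (List.replicate k 0)))
toList-↭-nonzeros (suc a ∷ α) with toList-↭-nonzeros α
... | k , e = k , ↭-prep (suc a) e

-- Both exponents have `m` entries in all, so equally many nonzero entries leave equally many zeros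
-- to append.
nonzeros-↭⇒toList-↭ : ∀ {α β : Exponent m} → nonzeros α ↭ nonzeros β → toList α ↭ toList β
nonzeros-↭⇒toList-↭ {α = α} {β} e with toList-↭-nonzeros α | toList-↭-nonzeros β
... | k , α↭ | l , β↭ = ↭-trans α↭ (↭-trans (++⁺ʳ _ e)
  (↭-trans (↭-reflexive (cong (λ k → nonzeros β ++ List.replicate k 0) k≡l)) (↭-sym β↭)))
  where
  open ≡-Reasoning
  length-padded : ∀ {γ : Exponent m} {k} → toList γ ↭ nonzeros γ ++ List.replicate k 0 →
                  m ≡ length (nonzeros γ) + k
  length-padded {γ = γ} {k} γ↭ = trans (sym (Vec.length-toList γ)) (trans (↭-length γ↭)
    (trans (List.length-++ (nonzeros γ)) (cong (length (nonzeros γ) +_) (List.length-replicate k))))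
  k≡l : k ≡ l
  k≡l = ℕ.+-cancelˡ-≡ (length (nonzeros β)) k l (begin
    length (nonzeros β) + k  ≡⟨ cong (_+ k) (↭-length e) ⟨
    length (nonzeros α) + k  ≡⟨ length-padded α↭ ⟨
    _                        ≡⟨ length-padded β↭ ⟩
    length (nonzeros β) + l  ∎)

-- Exponents with the same multiset of nonzero entries differ by a permutation of the
-- indeterminates, which leaves `f` unchanged.
coeff-nonzeros : ∀ {f : Poly m} {α β} → Symmetric f → nonzeros α ↭ nonzeros β → coeff f α ≡ coeff f β
coeff-nonzeros {f = f} {α} {β} f-sym e with toList-↭⇒permute {α = α} {β} (nonzeros-↭⇒toList-↭ e)
... | σ , refl = trans (sym (coeff-permute σ f β)) (coeff-≡ (f-sym σ) β)

nonzeros-permute : ∀ (σ : Permutation′ m) α → nonzeros (permute σ α) ↭ nonzeros α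
nonzeros-permute σ α = filter-↭ ℕ.nonZero? (toList-permute σ α)

nonzeros-++-0 : ∀ (α : Exponent n) p → nonzeros (α Vec.++ replicate p 0) ≡ nonzeros α
nonzeros-++-0 []          zero    = refl
nonzeros-++-0 []          (suc p) = nonzeros-++-0 [] p
nonzeros-++-0 (zero ∷ α)  p       = nonzeros-++-0 α p
nonzeros-++-0 (suc a ∷ α) p       = cong (suc a ∷_) (nonzeros-++-0 α p)

length-nonzeros : ∀ (α : Exponent n) → length (nonzeros α) ≤ n
length-nonzeros α = ℕ.≤-trans (List.length-filter ℕ.nonZero? (toList α))
  (ℕ.≤-reflexive (Vec.length-toList α))

-- Each nonzero entry adds at least one to the degree. This is what rules out long multisets in
-- degrees up to `n`.
length-nonzeros≤degree : ∀ (α : Exponent n) → length (nonzeros α) ≤ degree α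
length-nonzeros≤degree []          = z≤n
length-nonzeros≤degree (zero ∷ α)  = length-nonzeros≤degree α
length-nonzeros≤degree (suc a ∷ α) = s≤s (ℕ.≤-trans (length-nonzeros≤degree α) (ℕ.m≤n+m _ a))

sum-nonzeros : ∀ (α : Exponent n) → sum (nonzeros α) ≡ degree α
sum-nonzeros []          = refl
sum-nonzeros (zero ∷ α)  = sum-nonzeros α
sum-nonzeros (suc a ∷ α) = cong (suc a +_) (sum-nonzeros α)

-- Exponents from lists.

pad : ∀ m → List ℕ → Exponent m
pad m       []       = replicate m 0
-- A default: lists that are too long get truncated. The lemmas about `pad` therefore bound the
-- length.
pad zero    (x ∷ xs) = []
pad (suc m) (x ∷ xs) = x ∷ pad m xs

nonzeros-pad : ∀ {m} (xs : List ℕ) → length xs ≤ m → nonzeros (pad m xs) ≡ filter ℕ.nonZero? xs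
nonzeros-pad {m}     []           _         = nonzeros-++-0 [] m
nonzeros-pad {suc m} (zero ∷ xs)  (s≤s len) = nonzeros-pad xs len
nonzeros-pad {suc m} (suc x ∷ xs) (s≤s len) = cong (suc x ∷_) (nonzeros-pad xs len)

nonzeros-pad-nonzeros : ∀ (α : Exponent m) → length (nonzeros α) ≤ n →
                        nonzeros (pad n (nonzeros α)) ≡ nonzeros α
nonzeros-pad-nonzeros α len = trans (nonzeros-pad (nonzeros α) len) (List.filter-idem ℕ.nonZero? (toList α))

degree-pad : ∀ {m} (xs : List ℕ) → length xs ≤ m → degree (pad m xs) ≡ sum xs
degree-pad {m}     []       _         = trans (sym (sum-nonzeros (pad m []))) (cong sum (nonzeros-++-0 [] m))
degree-pad {suc m} (x ∷ xs) (s≤s len) = cong (x +_) (degree-pad xs len)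

-- Symmetric polynomials with prescribed coefficients.

box : ∀ m → ℕ → List (Exponent m)
box zero    D = [] ∷ []
box (suc m) D = cartesianProductWith _∷_ (upTo (suc D)) (box m D)

box-unique : ∀ m D → Unique (box m D)
box-unique zero    D = [] ∷ []
box-unique (suc m) D = Unique.cartesianProductWith⁺ _∷_ Vec.∷-injective (Unique.upTo⁺ (suc D)) (box-unique m D)

-- Each entry is at most the degree. The box also holds exponents of larger degree; what matters is
-- a finite list without repetitions that covers all degrees up to `D`.
degree≤⇒∈-box : ∀ {D} (α : Exponent m) → degree α ≤ D → α ∈ box m D
degree≤⇒∈-box []      _   = here refl
degree≤⇒∈-box (a ∷ α) deg = ∈-cartesianProductWith⁺ _∷_
  (∈-upTo⁺ (s≤s (ℕ.≤-trans (ℕ.m≤m+n a (degree α)) deg)))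
  (degree≤⇒∈-box α (ℕ.≤-trans (ℕ.m≤n+m (degree α) a) deg))

withCoeffs : (Exponent m → ℤ) → List (Exponent m) → Poly m
withCoeffs F = List.map (λ α → F α , α)

coeff-withCoeffs-∉ : ∀ (F : Exponent m → ℤ) {S α} → α ∉ S → coeff (withCoeffs F S) α ≡ 0ℤ
coeff-withCoeffs-∉ F {[]}        α∉ = refl
coeff-withCoeffs-∉ F {β ∷ S} {α} α∉ with β ≟ₑ α
... | yes refl = contradiction (here refl) α∉
... | no  _    = trans (ℤ.+-identityˡ _) (coeff-withCoeffs-∉ F (α∉ ∘ there))

-- Coefficients of equal exponents add up, so uniqueness ensures that `F α` is counted only once.
coeff-withCoeffs-∈ : ∀ (F : Exponent m → ℤ) {S α} → Unique S → α ∈ S → coeff (withCoeffs F S) α ≡ F α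
coeff-withCoeffs-∈ F {β ∷ S} {α} (β∉S ∷ uniq) α∈ with β ≟ₑ α | α∈
... | yes refl | _          = trans
  (cong (λ c → F β ℤ.+ c) (coeff-withCoeffs-∉ F (λ β∈S → All.lookup β∉S β∈S refl))) (ℤ.+-identityʳ (F β))
... | no β≢α   | here α≡β   = contradiction (sym α≡β) β≢α
... | no _     | there α∈S  = trans (ℤ.+-identityˡ _) (coeff-withCoeffs-∈ F uniq α∈S)

module _ (h : List ℕ → ℤ) (h-resp-↭ : ∀ {xs ys} → xs ↭ ys → h xs ≡ h ys)
         {D : ℕ} (h-bounded : ∀ xs → h xs ≢ 0ℤ → sum xs ≤ D) where

  private
    poly : ∀ m → Poly m
    poly m = withCoeffs (h ∘ nonzeros) (box m D)

    coeff-poly : ∀ (α : Exponent m) → coeff (poly m) α ≡ h (nonzeros α)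
    coeff-poly {m} α with Any.any? (α ≟ₑ_) (box m D)
    ... | yes α∈ = coeff-withCoeffs-∈ (h ∘ nonzeros) (box-unique m D) α∈
    -- Outside the box `h` must vanish, since a nonzero value would bound the degree by `D`.
    ... | no  α∉ with h (nonzeros α) ℤ.≟ 0ℤ
    ...   | yes h≡0 = trans (coeff-withCoeffs-∉ (h ∘ nonzeros) α∉) (sym h≡0)
    ...   | no  h≢0 = contradiction
      (degree≤⇒∈-box α (subst (_≤ D) (sum-nonzeros α) (h-bounded (nonzeros α) h≢0))) α∉

  -- A converse to `coeff-nonzeros`: the bound on the support of `h` makes the sum finite, and
  -- invariance of `h` under rearrangement makes it symmetric.
  symmetricWithCoeffs : ∃ λ f → Symmetric f × ∀ (α : Exponent m) → coeff f α ≡ h (nonzeros α)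
  symmetricWithCoeffs {m} = poly m , poly-sym , coeff-poly
    where
    poly-sym : Symmetric (poly m)
    poly-sym σ = mk≈ λ α → begin
      coeff (poly m ⟦ (λ i → var (σ ⟨$⟩ʳ i)) ⟧) α  ≡⟨ coeff-permute σ (poly m) α ⟩
      coeff (poly m) (permute σ α)                  ≡⟨ coeff-poly (permute σ α) ⟩
      h (nonzeros (permute σ α))                    ≡⟨ h-resp-↭ (nonzeros-permute σ α) ⟩
      h (nonzeros α)                                ≡⟨ coeff-poly α ⟨
      coeff (poly m) α                              ∎
      where open ≡-Reasoning

-- Injectivity in degrees up to `n`.

coeff-cong-short : ∀ {f g : Poly (n + p)} → Symmetric f → Symmetric g →
  (∀ γ → coeff f (γ Vec.++ replicate p 0) ≡ coeff g (γ Vec.++ replicate p 0)) →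
  ∀ α → length (nonzeros α) ≤ n → coeff f α ≡ coeff g α
coeff-cong-short {n} {p} {f} {g} f-sym g-sym eq α len = begin
  coeff f α                        ≡⟨ coeff-nonzeros f-sym α↭ ⟩
  coeff f (γ Vec.++ replicate p 0) ≡⟨ eq γ ⟩
  coeff g (γ Vec.++ replicate p 0) ≡⟨ coeff-nonzeros g-sym α↭ ⟨
  coeff g α                        ∎
  where
  open ≡-Reasoning
  -- The nonzero entries of α, at most `n` of them, are moved to the first `n` places, where the
  -- hypothesis compares the coefficients.
  γ = pad n (nonzeros α)
  α↭ : nonzeros α ↭ nonzeros (γ Vec.++ replicate p 0)
  α↭ = ↭-reflexive (sym (trans (nonzeros-++-0 γ p) (nonzeros-pad-nonzeros α len)))

-- Wherever one of the two coefficients is nonzero, homogeneity gives degree `r`, hence at most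
-- `r ≤ n` nonzero entries, and `coeff-cong-short` applies.
setZero-injective : ∀ {f g : Poly (n + p)} → r ≤ n → Symmetric f → Symmetric g →
  Homogeneous r f → Homogeneous r g → f ⟦ setZero n p ⟧ ≈ g ⟦ setZero n p ⟧ → f ≈ g
setZero-injective {n} {p} {r} {f} {g} r≤n f-sym g-sym f-hom g-hom eq = mk≈ go
  where
  agree : ∀ α → degree α ≡ r → coeff f α ≡ coeff g α
  agree α refl = coeff-cong-short {n} {p} f-sym g-sym
    (λ γ → trans (sym (coeff-setZero n p f γ)) (trans (coeff-≡ eq γ) (coeff-setZero n p g γ)))
    α (ℕ.≤-trans (length-nonzeros≤degree α) r≤n)
  go : ∀ α → coeff f α ≡ coeff g α
  go α with coeff f α ℤ.≟ 0ℤ | coeff g α ℤ.≟ 0ℤ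
  ... | yes f≡0 | yes g≡0 = trans f≡0 (sym g≡0)
  ... | no  f≢0 | _       = agree α (f-hom α f≢0)
  ... | yes _   | no  g≢0 = agree α (g-hom α g≢0)

-- Lifting symmetric polynomials.

degreeBound : Poly n → ℕ
degreeBound []            = 0
degreeBound ((c , α) ∷ f) = degree α ⊔ degreeBound f

degree≤degreeBound : ∀ (f : Poly n) {α} → coeff f α ≢ 0ℤ → degree α ≤ degreeBound f
degree≤degreeBound []            c≢0 = contradiction refl c≢0
degree≤degreeBound ((c , β) ∷ f) {α} c≢0 with β ≟ₑ α
... | yes refl = ℕ.m≤m⊔n (degree β) _
... | no  _    = ℕ.≤-trans (degree≤degreeBound f (λ f≡0 → c≢0 (trans (ℤ.+-identityˡ _) f≡0)))
  (ℕ.m≤n⊔m (degree β) _)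

when : {A : Set} → Dec A → ℤ → ℤ
when (yes _) c = c
when (no  _) c = 0ℤ

when-yes : ∀ {A : Set} (a? : Dec A) {c} → A → when a? c ≡ c
when-yes (yes _) _ = refl
when-yes (no ¬a) a = contradiction a ¬a

when-no : ∀ {A : Set} (a? : Dec A) {c} → ¬ A → when a? c ≡ 0ℤ
when-no (yes a) ¬a = contradiction a ¬a
when-no (no _)  _  = refl

when-support : ∀ {A : Set} (a? : Dec A) {c} → when a? c ≢ 0ℤ → A × c ≢ 0ℤ
when-support (yes a) c≢0 = a , c≢0
when-support (no _)  0≢0 = contradiction refl 0≢0

-- Values on lists longer than `n` become invisible once the last `p` indeterminates are zero.
-- Choosing zero there keeps the support bounded, preserves homogeneity and keeps `pad` from
-- truncating.
liftCoeff : Poly n → List ℕ → ℤ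
liftCoeff {n} g xs = when (length xs ℕ.≤? n) (coeff g (pad n xs))

liftCoeff-support : ∀ (g : Poly n) xs → liftCoeff g xs ≢ 0ℤ →
                    length xs ≤ n × coeff g (pad n xs) ≢ 0ℤ
liftCoeff-support {n} g xs = when-support (length xs ℕ.≤? n)

-- Rearranging preserves the length, so the two guards agree. Zeros in the lists are harmless,
-- because only the nonzero entries of the padded exponents are compared.
liftCoeff-resp-↭ : ∀ {g : Poly n} → Symmetric g → ∀ {xs ys} → xs ↭ ys → liftCoeff g xs ≡ liftCoeff g ys
liftCoeff-resp-↭ {n} {g} g-sym {xs} {ys} e with length xs ℕ.≤? n | length ys ℕ.≤? n
... | yes xs≤ | yes ys≤ = coeff-nonzeros g-sym (↭-trans (↭-reflexive (nonzeros-pad xs xs≤))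
                            (↭-trans (filter-↭ ℕ.nonZero? e) (↭-reflexive (sym (nonzeros-pad ys ys≤)))))
... | yes xs≤ | no  ys≰ = contradiction (subst (_≤ n) (↭-length e) xs≤) ys≰
... | no  xs≰ | yes ys≤ = contradiction (subst (_≤ n) (sym (↭-length e)) ys≤) xs≰
... | no  _   | no  _   = refl

-- The lift is chosen independently of `r`, so one construction serves both the whole ring and each
-- graded piece.
setZero-lift : ∀ n p (g : Poly n) → Symmetric g →
  ∃ λ f → Symmetric f × f ⟦ setZero n p ⟧ ≈ g × (∀ {r} → Homogeneous r g → Homogeneous r f)
setZero-lift n p g g-sym with symmetricWithCoeffs (liftCoeff g) (liftCoeff-resp-↭ g-sym) {degreeBound g}
  (λ xs l≢0 → let len , c≢0 = liftCoeff-support g xs l≢0 in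
    subst (_≤ degreeBound g) (degree-pad xs len) (degree≤degreeBound g c≢0)) {n + p}
... | f , f-sym , coeff-f = f , f-sym , mk≈ restrict , hom
  where
  open ≡-Reasoning
  restrict : ∀ γ → coeff (f ⟦ setZero n p ⟧) γ ≡ coeff g γ
  restrict γ = begin
    coeff (f ⟦ setZero n p ⟧) γ                    ≡⟨ coeff-setZero n p f γ ⟩
    coeff f (γ Vec.++ replicate p 0)               ≡⟨ coeff-f _ ⟩
    liftCoeff g (nonzeros (γ Vec.++ replicate p 0)) ≡⟨ cong (liftCoeff g) (nonzeros-++-0 γ p) ⟩
    -- The guard holds because γ has only `n` entries.
    liftCoeff g (nonzeros γ)
      ≡⟨ when-yes (_ ℕ.≤? n) (length-nonzeros γ) ⟩
    coeff g (pad n (nonzeros γ))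
      ≡⟨ coeff-nonzeros g-sym (↭-reflexive (nonzeros-pad-nonzeros γ (length-nonzeros γ))) ⟩
    coeff g γ ∎
  hom : ∀ {r} → Homogeneous r g → Homogeneous r f
  hom g-hom α c≢0 =
    let len , cg≢0 = liftCoeff-support g (nonzeros α) (λ l≡0 → c≢0 (trans (coeff-f α) l≡0)) in
    trans (sym (sum-nonzeros α)) (trans (sym (degree-pad (nonzeros α) len)) (g-hom _ cg≢0))

-- A nonzero kernel element in each degree above `n`.

longCoeff : ℕ → ℕ → List ℕ → ℤ
longCoeff n r xs = when ((n ℕ.<? length xs) ×-dec (sum xs ℕ.≟ r)) 1ℤ

longCoeff-support : ∀ n r xs → longCoeff n r xs ≢ 0ℤ → n < length xs × sum xs ≡ r
longCoeff-support n r xs l≢0 =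
  proj₁ (when-support ((n ℕ.<? length xs) ×-dec (sum xs ℕ.≟ r)) l≢0)

longCoeff-resp-↭ : ∀ {n r xs ys} → xs ↭ ys → longCoeff n r xs ≡ longCoeff n r ys
longCoeff-resp-↭ e = cong₂ (λ l s → when ((_ ℕ.<? l) ×-dec (s ℕ.≟ _)) 1ℤ) (↭-length e) (sum-↭ e)

-- The witness for f ≉ 0 is the exponent (r − n, 1, …, 1, 0, …, 0) with n ones.
setZero-kernel : ∀ n p r → 1 ≤ p → n < r →
  ∃ λ (f : Poly (n + p)) → Symmetric f × Homogeneous r f × f ⟦ setZero n p ⟧ ≈ 0ₚ × ∃ λ α → coeff f α ≢ 0ℤ
setZero-kernel n p r 1≤p n<r with ℕ.m≤n⇒∃[o]m+o≡n n<r
  | symmetricWithCoeffs (longCoeff n r) longCoeff-resp-↭ {r}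
      (λ xs l≢0 → ℕ.≤-reflexive (proj₂ (longCoeff-support n r xs l≢0))) {n + p}
-- Here `r` is `suc n + k`, so the entry `suc k` of the witness is r - n.
... | k , refl | f , f-sym , coeff-f = f , f-sym , hom , mk≈ vanish , pad (n + p) xs , nonzero
  where
  hom : Homogeneous r f
  hom α c≢0 = trans (sym (sum-nonzeros α))
    (proj₂ (longCoeff-support n r (nonzeros α) (λ l≡0 → c≢0 (trans (coeff-f α) l≡0))))
  vanish : ∀ γ → coeff (f ⟦ setZero n p ⟧) γ ≡ 0ℤ
  vanish γ = trans (coeff-setZero n p f γ) (trans (coeff-f _) (trans (cong (longCoeff n r) (nonzeros-++-0 γ p))
    (when-no ((n ℕ.<? _) ×-dec (_ ℕ.≟ r)) (λ (long , _) → ℕ.<⇒≱ long (length-nonzeros γ)))))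
  xs = suc k ∷ List.replicate n 1
  length-xs : length xs ≡ suc n
  length-xs = cong suc (List.length-replicate n)
  sum-ones : ∀ n → sum (List.replicate n 1) ≡ n
  sum-ones zero    = refl
  sum-ones (suc n) = cong suc (sum-ones n)
  sum-xs : sum xs ≡ r
  sum-xs = cong suc (trans (cong (k +_) (sum-ones n)) (ℕ.+-comm k n))
  nonzeros-xs : nonzeros (pad (n + p) xs) ≡ xs
  nonzeros-xs = trans
    -- The n + 1 entries fit into n + p places because `1 ≤ p`.
    (nonzeros-pad xs (ℕ.≤-trans (ℕ.≤-reflexive (trans length-xs (ℕ.+-comm 1 n))) (ℕ.+-monoʳ-≤ n 1≤p)))
    (List.filter-all ℕ.nonZero? (_ ∷ All.replicate⁺ n _))
  coeff≡1 : coeff f (pad (n + p) xs) ≡ 1ℤ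
  coeff≡1 = trans (coeff-f _) (trans (cong (longCoeff n r) nonzeros-xs)
    (when-yes ((n ℕ.<? length xs) ×-dec (sum xs ℕ.≟ r)) (ℕ.≤-reflexive (sym length-xs) , sum-xs)))
  nonzero : coeff f (pad (n + p) xs) ≢ 0ℤ
  nonzero c≡0 with trans (sym coeff≡1) c≡0
  ... | ()

-- The maps on the ring and on its graded pieces.

Π-isRingHomomorphism : ∀ n p →
  IsRingHomomorphism (CommutativeRing.rawRing (Λ (n + p))) (CommutativeRing.rawRing (Λ n)) (Π n p)
Π-isRingHomomorphism n p = record
  { isSemiringHomomorphism = record
    { isNearSemiringHomomorphism = record
      { +-isMonoidHomomorphism = record
        { isMagmaHomomorphism = record
          { isRelHomomorphism = record { cong = ⟦⟧-cong (setZero n p) }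
          ; homo              = λ (f , _) (g , _) → ⟦⟧-+ f g (setZero n p)
          }
        ; ε-homo = mk≈ λ _ → refl
        }
      ; *-homo = λ (f , _) (g , _) → ⟦⟧-* f g (setZero n p)
      }
    ; 1#-homo = ⟦⟧-const 1ℤ (setZero n p)
    }
  ; -‿homo = λ (f , _) → ⟦⟧-neg f (setZero n p)
  }

Π-surjective : ∀ n p → Surjective (CommutativeRing._≈_ (Λ (n + p))) (CommutativeRing._≈_ (Λ n)) (Π n p)
Π-surjective n p (g , g-sym) with setZero-lift n p g g-sym
... | f , f-sym , f↦g , _ = (f , f-sym) , λ z≈f → ≈-trans (⟦⟧-cong (setZero n p) z≈f) f↦g
  where open CommutativeRing (polyRing n) using () renaming (trans to ≈-trans)

Πʳ-surjective : ∀ n p r →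
  Surjective (AbelianGroup._≈_ (Λʳ (n + p) r)) (AbelianGroup._≈_ (Λʳ n r)) (Πʳ n p r)
Πʳ-surjective n p r ((g , g-sym) , g-hom) with setZero-lift n p g g-sym
... | f , f-sym , f↦g , hom =
  ((f , f-sym) , hom g-hom) , λ z≈f → ≈-trans (⟦⟧-cong (setZero n p) z≈f) f↦g
  where open CommutativeRing (polyRing n) using () renaming (trans to ≈-trans)

Πʳ-isGroupIsomorphism : ∀ n p r → r ≤ n →
  IsGroupIsomorphism (AbelianGroup.rawGroup (Λʳ (n + p) r)) (AbelianGroup.rawGroup (Λʳ n r)) (Πʳ n p r)
Πʳ-isGroupIsomorphism n p r r≤n = record
  { isGroupMonomorphism = record
    { isGroupHomomorphism = record
      { isMonoidHomomorphism = record
        { isMagmaHomomorphism = record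
          { isRelHomomorphism = record { cong = ⟦⟧-cong (setZero n p) }
          ; homo              = λ (f , _) (g , _) → Π-hom.+-homo f g
          }
        ; ε-homo = Π-hom.0#-homo
        }
      ; ⁻¹-homo = λ (f , _) → Π-hom.-‿homo f
      }
    ; injective = λ { {(f , f-sym) , f-hom} {(g , g-sym) , g-hom} →
        setZero-injective r≤n f-sym g-sym f-hom g-hom }
    }
  ; surjective = Πʳ-surjective n p r
  }
  where module Π-hom = IsRingHomomorphism (Π-isRingHomomorphism n p)

corollary1 : (n p : ℕ) → 1 ≤ p →
    (IsRingHomomorphism (CommutativeRing.rawRing (Λ (n + p))) (CommutativeRing.rawRing (Λ n)) (Π n p)
    × ((r : ℕ) (f : SymPoly (n + p)) → Homogeneous r (proj₁ f) → Homogeneous r (proj₁ (Π n p f)))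
    × Surjective (CommutativeRing._≈_ (Λ (n + p))) (CommutativeRing._≈_ (Λ n)) (Π n p))
    × ((r : ℕ) →
    Surjective (AbelianGroup._≈_ (Λʳ (n + p) r)) (AbelianGroup._≈_ (Λʳ n r)) (Πʳ n p r)
    × (IsGroupIsomorphism (AbelianGroup.rawGroup (Λʳ (n + p) r)) (AbelianGroup.rawGroup (Λʳ n r)) (Πʳ n p r)
    ⇔ r ≤ n))
corollary1 n p 1≤p =
    ( Π-isRingHomomorphism n p
    , (λ r (f , _) → setZero-homogeneous n p f)
    , Π-surjective n p)
  , λ r → Πʳ-surjective n p r , mk⇔ (iso⇒r≤n r) (Πʳ-isGroupIsomorphism n p r)
  where
  iso⇒r≤n : ∀ r →
    IsGroupIsomorphism (AbelianGroup.rawGroup (Λʳ (n + p) r)) (AbelianGroup.rawGroup (Λʳ n r)) (Πʳ n p r) → r ≤ n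
  iso⇒r≤n r iso with r ℕ.≤? n
  ... | yes r≤n = r≤n
  -- For r > n, injectivity would identify the kernel element with zero, although one of its
  -- coefficients is nonzero.
  ... | no  r≰n with setZero-kernel n p r 1≤p (ℕ.≰⇒> r≰n)
  ...   | f , f-sym , f-hom , f↦0 , α , c≢0 =
    contradiction (coeff-≡ (injective {(f , f-sym) , f-hom} {AbelianGroup.ε (Λʳ (n + p) r)} f↦0) α) c≢0
    where open IsGroupIsomorphism iso using (injective)
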